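{- Let $p$ be a prime and $n\ge1$, and suppose $p^n-1=st$ with positive integers $s<t$ and $\gcd(s,t)=1$. Let $\alpha$ be a generator of $\mathbb{F}_{p^n}^\times$, $\beta=\alpha^t$, $\gamma=\alpha^s$. Let $S_1,S_2\subset\mathbb{Z}_s\times\mathbb{Z}_t$ be two disjoint linearly independent patterns, of sizes $m_1$ and $m_2$ respectively, and let $V_1,V_2\subset\mathbb{F}_{p^n}$ be the $\mathbb{F}_p$-spans of $A|_{S_1}$ and $A|_{S_2}$. Suppose $\dim_{\mathbb{F}_p}V_1+\dim_{\mathbb{F}_p}V_2\le n$. Then there exists $(a,b)\in\mathbb{Z}_s\times\mathbb{Z}_t$ such that $T_{a,b}(S_2)$ is disjoint from $S_1$ and the pattern $S_1\cup T_{a,b}(S_2)$ is linearly independent.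
   Context: $\mathbb{Z}_s=\mathbb{Z}/s\mathbb{Z}$, $\mathbb{Z}_t=\mathbb{Z}/t\mathbb{Z}$; $(i,j)\mapsto\beta^i\gamma^j$ is a well-defined bijection $\mathbb{Z}_s\times\mathbb{Z}_t\to\mathbb{F}_{p^n}^\times$. A pattern is a subset $S\subset\mathbb{Z}_s\times\mathbb{Z}_t$, and $A|_S=\{\beta^i\gamma^j:(i,j)\in S\}$. $S$ is a linearly independent pattern if the $|S|$ elements of $A|_S$ are linearly independent over $\mathbb{F}_p$. The toroidal translation $T_{a,b}:\mathbb{Z}_s\times\mathbb{Z}_t\to\mathbb{Z}_s\times\mathbb{Z}_t$ is $T_{a,b}(i,j)=(i+a \bmod s,\ j+b\bmod t)$. -}

module Defs where

open import Algebra.Apartness.Bundles using (HeytingField; HeytingCommutativeRing)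
open import Algebra.Bundles using (CommutativeRing; Semiring)
import Algebra.Definitions.RawSemiring as RawSemiringDefinitions
open import Data.Fin using (Fin; toℕ)
open import Data.Fin.Properties using (_≟_; any?)
open import Data.List using (List; allFin; cartesianProduct; filter; length; lookup)
open import Data.Nat using (ℕ; _+_; NonZero)
open import Data.Nat.DivMod using (_mod_)
open import Data.Product using (_×_; _,_; ∃)
open import Data.Product.Properties using (≡-dec)
open import Data.Vec.Functional using (Vector)
open import Function.Bundles using (Inverse)
open import Level using (_⊔_; 0ℓ)
open import Relation.Binary.PropositionalEquality using (_≡_; setoid)
open import Relation.Nullary.Decidable using (map′; _×-dec_)
open import Relation.Unary using (Pred; Decidable; _∈_; _⊆_)

-- ℤ/s × ℤ/t, a residue class being given by its representative in {0, …, s - 1}.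
Torus : ℕ → ℕ → Set
Torus s t = Fin s × Fin t

module _ {s t : ℕ} where

  -- A subset of the torus is a predicate together with a decision procedure S?;
  -- its members are listed without repetition, so that S can index a family.
  elements : {S : Pred (Torus s t) 0ℓ} → Decidable S → List (Torus s t)
  elements S? = filter S? (cartesianProduct (allFin s) (allFin t))

  size : {S : Pred (Torus s t) 0ℓ} → Decidable S → ℕ
  size S? = length (elements S?)

  Image : (Torus s t → Torus s t) → Pred (Torus s t) 0ℓ → Pred (Torus s t) 0ℓ
  Image f S y = ∃ λ x → x ∈ S × f x ≡ y

  image? : (f : Torus s t → Torus s t) {S : Pred (Torus s t) 0ℓ} →
           Decidable S → Decidable (Image f S)
  image? f S? y =
    map′ (λ (i , j , q) → (i , j) , q) (λ ((i , j) , q) → i , j , q)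
         (any? λ i → any? λ j → S? (i , j) ×-dec ≡-dec _≟_ _≟_ (f (i , j)) y)

  T : .{{_ : NonZero s}} .{{_ : NonZero t}} → Fin s → Fin t → Torus s t → Torus s t
  T a b (i , j) = (toℕ i + toℕ a) mod s , (toℕ j + toℕ b) mod t

module FieldNotions {c ℓ₁ ℓ₂} (F : HeytingField c ℓ₁ ℓ₂) where

  open HeytingField F using (Carrier; _≈_; _#_; 0#; heytingCommutativeRing) renaming (_*_ to _*F_)
  open CommutativeRing (HeytingCommutativeRing.commutativeRing heytingCommutativeRing)
    using (semiring) renaming (setoid to setoidF)
  open RawSemiringDefinitions (Semiring.rawSemiring semiring) public
    using (sum) renaming (_^_ to _^F_; _×_ to _×F_)

  -- If F has finitely many elements then _≈_ is decidable and x # y is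
  -- equivalent to ¬ x ≈ y, so F is a finite field in the usual sense.
  HasCardinality : ℕ → Set (c ⊔ ℓ₁)
  HasCardinality q = Inverse setoidF (setoid (Fin q))

  -- Natural exponents suffice because every element of a finite group has
  -- finite order.
  GeneratesUnits : Carrier → Set (c ⊔ ℓ₁ ⊔ ℓ₂)
  GeneratesUnits α = α # 0# × (∀ x → x # 0# → ∃ λ k → α ^F k ≈ x)

  -- 𝔽_p-linear algebra in F.  When F has pⁿ elements its characteristic is p,
  -- and the residue class of k ∈ {0, …, p - 1} acts on F as k-fold addition.
  module Over (p : ℕ) where

    linearCombination : ∀ {m} → Vector (Fin p) m → Vector Carrier m → Carrier
    linearCombination κ v = sum λ i → toℕ (κ i) ×F v i

    LinearlyIndependent : ∀ {m} → Vector Carrier m → Set ℓ₁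
    LinearlyIndependent v =
      ∀ κ → linearCombination κ v ≈ 0# → ∀ i → toℕ (κ i) ≡ 0

    Span : ∀ {m} → Vector Carrier m → Pred Carrier ℓ₁
    Span v x = ∃ λ κ → x ≈ linearCombination κ v

    record HasDimension {ℓ} (V : Pred Carrier ℓ) (d : ℕ) : Set (c ⊔ ℓ₁ ⊔ ℓ) where
      field
        basis       : Vector Carrier d
        basis∈V     : ∀ i → basis i ∈ V
        independent : LinearlyIndependent basis
        spanning    : V ⊆ Span basis

  module _ {s t : ℕ} (β γ : Carrier) where

    A : Torus s t → Carrier
    A (i , j) = (β ^F toℕ i) *F (γ ^F toℕ j)

    restrict : {S : Pred (Torus s t) 0ℓ} (S? : Decidable S) → Vector Carrier (size S?)
    restrict S? k = A (lookup (elements S?) k)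

    LinearlyIndependentPattern : ℕ → {S : Pred (Torus s t) 0ℓ} → Decidable S → Set ℓ₁
    LinearlyIndependentPattern p S? = Over.LinearlyIndependent p (restrict S?)

{-# OPTIONS --safe #-}

-- A pair (a , b) serves as soon as, for u = β^a γ^b, the span V₁ meets u V₂ only in 0.  A unit u that
-- fails this satisfies v + u w = 0 for some nonzero v ∈ V₁ and w ∈ V₂, and v and w determine u.  Hence
-- at most (p^m₁ - 1) (p^m₂ - 1) units fail, which is less than pⁿ - 1 because m₁ + m₂ ≤ n, whereas
-- (i , j) ↦ β^i γ^j takes pⁿ - 1 distinct values.
module Submission where

open import Defs
open import Algebra.Apartness.Bundles using (HeytingField; HeytingCommutativeRing)
import Algebra.Apartness.Properties.HeytingCommutativeRing as HeytingProperties
open import Algebra.Bundles using (CommutativeRing)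
import Algebra.Properties.CommutativeSemigroup as CommutativeSemigroupProperties
import Algebra.Properties.Ring as RingProperties
import Algebra.Properties.Semiring.Exp as SemiringExp
import Algebra.Properties.Semiring.Mult as SemiringMult
import Algebra.Properties.Semiring.Sum as SemiringSum
open import Data.Fin using (Fin; zero; suc; toℕ; fromℕ<; combine; remQuot; punchIn; punchOut; finToFun; funToFin)
open import Data.Fin.Permutation using (permutation)
open import Data.Fin.Properties using (_≟_; any?; all?; toℕ<n; toℕ-fromℕ<; toℕ-injective; pigeonhole; injective⇒≤; <⇒notInjective; ¬∀⟶∃¬; combine-injective; combine-remQuot; punchInᵢ≢i; punchIn-punchOut; finToFun-funToFin; funToFin-finToFin)
open import Data.List using (List; []; _∷_; _++_; map; lookup; allFin; cartesianProduct)
open import Data.List.Membership.Propositional using () renaming (_∈_ to _∈ₗ_)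
open import Data.List.Membership.Propositional.Properties using (∈-lookup; ∈-filter⁺; ∈-filter⁻; ∈-cartesianProduct⁺; ∈-allFin; ∈-++⁺ˡ; ∈-++⁺ʳ; ∈-++⁻; ∈-map⁺; ∈-map⁻)
open import Data.List.Membership.Propositional.Properties.WithK using (unique∧set⇒bag)
open import Data.List.Relation.Binary.BagAndSetEquality using (∼bag⇒↭)
open import Data.List.Relation.Binary.Permutation.Propositional using (_↭_; prep; swap) renaming (refl to ↭-refl; trans to ↭-trans)
import Data.List.Relation.Unary.All as All
open import Data.List.Relation.Unary.AllPairs using (_∷_)
open import Data.List.Relation.Unary.Any using (index)
open import Data.List.Relation.Unary.Any.Properties using (lookup-index)
open import Data.List.Relation.Unary.Unique.Propositional using (Unique)
import Data.List.Relation.Unary.Unique.Propositional.Properties as Unique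
open import Data.Nat using (ℕ; zero; suc; pred; _+_; _*_; _∸_; _^_; _≤_; _<_; NonZero; >-nonZero⁻¹; nonTrivial⇒n>1; z≤n; s≤s; ∣_-_∣)
open import Data.Nat.Coprimality using (Coprime; gcd≡1⇒coprime; coprime-divisor)
import Data.Nat.Coprimality as Coprimality
open import Data.Nat.DivMod using (%-congʳ; m∣n⇒o%n%m≡o%m; _%_; _/_; _mod_; m≡m%n+[m/n]*n; m%n<n; m<n⇒m%n≡m; %-remove-+ˡ; %-remove-+ʳ)
open import Data.Nat.Divisibility using (_∣_; divides; ∣-refl; ∣1⇒≡1; ∣⇒≤; m∣m*n; n∣m*n; m%n≡0⇒n∣m)
open import Data.Nat.GCD using (gcd)
open import Data.Nat.Primality using (Prime; prime⇒nonZero; prime⇒nonTrivial; ¬prime[1])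
import Data.Nat.Properties as ℕ
open import Data.Product using (_×_; _,_; ∃; ∃₂; proj₁; proj₂)
open import Data.Product.Properties using (≡-dec)
open import Data.Sum using (_⊎_; inj₁; inj₂)
open import Data.Vec.Functional using (Vector)
open import Function using (_∘_; mk⇔)
open import Function.Bundles using (Inverse)
open import Level using (0ℓ)
open import Relation.Binary.PropositionalEquality using (_≡_; _≢_; _≗_; cong; cong₂; subst)
import Relation.Binary.PropositionalEquality as ≡
import Relation.Binary.Reasoning.Setoid as SetoidReasoning
open import Relation.Binary.Definitions using (tri<; tri≈; tri>)
open import Relation.Nullary using (¬_; Dec; yes; no; contradiction)
open import Relation.Nullary.Decidable using (decidable-stable; map′)
open import Relation.Unary using (Pred; Decidable; _⊥_; _∈_)
open import Relation.Unary.Properties using (_∪?_)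

-- Neither the characteristic of the field nor the order of `α` is given: that `p` annihilates the
-- field, and that α^k = α^l only if k ≡ l modulo st, are both extracted from the cardinality. The
-- second fact and coprimality make the values β^i γ^j distinct. Since β^s = γ^t = 1, translation by
-- (a, b) multiplies the elements of a pattern by u = β^a γ^b. A relation on a disjoint union is
-- thus an equation v + u w = 0, and a point common to S₁ and the translate would yield such an
-- equation with v nonzero; one condition on u gives both disjointness and independence. Relations
-- are handled with natural coefficients, divisibility by `p` standing for vanishing. Such
-- coefficients can be added, and negated by complement to `p`, without any arithmetic on `Fin p`.

-- Remainders, and the inequality behind the count

%-≡⇒∣ : ∀ {d} .{{_ : NonZero d}} k l → k % d ≡ l % d → d ∣ ∣ k - l ∣
%-≡⇒∣ {d} k l eq = divides ∣ k / d - l / d ∣ (begin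
  ∣ k - l ∣                                    ≡⟨ cong₂ ∣_-_∣ (m≡m%n+[m/n]*n k d) (m≡m%n+[m/n]*n l d) ⟩
  ∣ k % d + k / d * d - l % d + l / d * d ∣    ≡⟨ cong (λ r → ∣ k % d + k / d * d - r + l / d * d ∣) (≡.sym eq) ⟩
  ∣ k % d + k / d * d - k % d + l / d * d ∣    ≡⟨ ℕ.∣m+n-m+o∣≡∣n-o∣ (k % d) _ _ ⟩
  ∣ k / d * d - l / d * d ∣                    ≡⟨ ℕ.*-distribʳ-∣-∣ d (k / d) (l / d) ⟨
  ∣ k / d - l / d ∣ * d                        ∎)
  where open ≡.≡-Reasoning

-- By coprimality `d` divides `∣ k - l ∣`, which is smaller than `d` and hence zero.
*-cancelˡ-% : ∀ {d} .{{_ : NonZero d}} e → Coprime d e → ∀ {k l} → k < d → l < d →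
              (e * k) % d ≡ (e * l) % d → k ≡ l
*-cancelˡ-% {d} e coprime {k} {l} k<d l<d eq
  with ∣ k - l ∣ in gap
     | coprime-divisor coprime (subst (d ∣_) (≡.sym (ℕ.*-distribˡ-∣-∣ e k l)) (%-≡⇒∣ (e * k) (e * l) eq))
... | zero    | _   = ℕ.∣m-n∣≡0⇒m≡n gap
... | suc _   | d∣g = contradiction (subst (_< d) gap gap<d) (ℕ.≤⇒≯ (∣⇒≤ d∣g))
  where
  gap<d : ∣ k - l ∣ < d
  gap<d = ℕ.≤-<-trans (ℕ.∣m-n∣≤m⊔n k l) (ℕ.⊔-lub k<d l<d)

-- Uniqueness in the Chinese remainder theorem: modulo `s` the term `s * j` disappears and `t` is
-- cancellable. The other coordinate is recovered by exchanging `s` and `t`.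
remainder-injective : ∀ {s t} .{{_ : NonZero s}} .{{st≢0 : NonZero (s * t)}} → Coprime s t →
                      ∀ {i i′ j j′} → i < s → i′ < s →
                      (t * i + s * j) % (s * t) ≡ (t * i′ + s * j′) % (s * t) → i ≡ i′
remainder-injective {s} {t} coprime {i} {i′} {j} {j′} i<s i′<s eq =
  *-cancelˡ-% t coprime i<s i′<s (begin
    (t * i) % s                        ≡⟨ reduce i j ⟨
    (t * i + s * j) % (s * t) % s      ≡⟨ cong (_% s) eq ⟩
    (t * i′ + s * j′) % (s * t) % s    ≡⟨ reduce i′ j′ ⟩
    (t * i′) % s                       ∎)
  where
  open ≡.≡-Reasoning
  reduce : ∀ k l → (t * k + s * l) % (s * t) % s ≡ (t * k) % s
  reduce k l = ≡.trans (m∣n⇒o%n%m≡o%m s (s * t) _ (m∣m*n t)) (%-remove-+ʳ (t * k) (m∣m*n l))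

∣m+[d∸n]⇒≡ : ∀ {d} .{{_ : NonZero d}} {m n} → m < d → n < d → d ∣ m + (d ∸ n) → m ≡ n
∣m+[d∸n]⇒≡ {d} {m} {n} m<d n<d d∣m+[d∸n] = begin
  m                      ≡⟨ reduce m<d ∣-refl ⟨
  (d + m) % d            ≡⟨ cong (_% d) (ℕ.+-comm d m) ⟩
  (m + d) % d            ≡⟨ cong (λ e → (m + e) % d) (ℕ.m∸n+n≡m (ℕ.<⇒≤ n<d)) ⟨
  (m + (d ∸ n + n)) % d  ≡⟨ cong (_% d) (ℕ.+-assoc m (d ∸ n) n) ⟨
  (m + (d ∸ n) + n) % d  ≡⟨ reduce n<d d∣m+[d∸n] ⟩
  n                      ∎
  where
  open ≡.≡-Reasoning
  reduce : ∀ {k r} → r < d → d ∣ k → (k + r) % d ≡ r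
  reduce {r = r} r<d d∣k = ≡.trans (%-remove-+ˡ r d∣k) (m<n⇒m%n≡m r<d)

-- Meant for powers of `p`. Passing from P Q to (P - 1)(Q - 1) loses P + Q - 1, which is at least 2
-- and so outweighs the `suc`, unless P = Q = 1. When a factor `pred P` is zero, `0 < N` decides.
pred*pred< : ∀ P Q {N} → 0 < N → P * Q ≤ suc N → pred P * pred Q < N
pred*pred< zero          Q       0<N _        = 0<N
pred*pred< (suc P)       zero    {N} 0<N _    = subst (_< N) (≡.sym (ℕ.*-zeroʳ P)) 0<N
pred*pred< (suc zero)    (suc Q) 0<N _        = 0<N
pred*pred< (suc (suc P)) (suc Q) {N} 0<N PQ≤ = begin-strict
  suc P * Q                <⟨ ℕ.m<m+n (suc P * Q) (s≤s z≤n) ⟩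
  suc P * Q + suc P        ≡⟨ ℕ.+-comm (suc P * Q) (suc P) ⟩
  suc P + suc P * Q        ≡⟨ ℕ.*-suc (suc P) Q ⟨
  suc P * suc Q            ≤⟨ ℕ.m≤n+m (suc P * suc Q) Q ⟩
  Q + suc P * suc Q        ≤⟨ ℕ.≤-pred PQ≤ ⟩
  N                        ∎
  where open ℕ.≤-Reasoning

-- Numbering the nonzero coefficient vectors

funToFin-cong : ∀ {m n} {f g : Fin m → Fin n} → f ≗ g → funToFin f ≡ funToFin g
funToFin-cong {zero}  f≗g = ≡.refl
funToFin-cong {suc m} f≗g = cong₂ combine (f≗g zero) (funToFin-cong (f≗g ∘ suc))

-- The bound is a variable so that it may become `p ^ m`, which is not visibly a successor as
-- `punchIn` would require.
avoid : ∀ {P} → Fin P → Fin (pred P) → Fin P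
avoid {suc P} z = punchIn z

avoid-≢ : ∀ {P} (z : Fin P) c → avoid z c ≢ z
avoid-≢ {suc P} z c = punchInᵢ≢i z c

avoid-surjective : ∀ {P} {z i : Fin P} → z ≢ i → ∃ λ c → avoid z c ≡ i
avoid-surjective {suc P} z≢i = punchOut z≢i , punchIn-punchOut z≢i

module _ {p : ℕ} .{{_ : NonZero p}} {m : ℕ} where

  IsZero : Vector (Fin p) m → Set
  IsZero κ = ∀ i → toℕ (κ i) ≡ 0

  zeroCode : Fin (p ^ m)
  zeroCode = funToFin {m} {p} (λ _ → 0 mod p)

  toℕ-0-mod : toℕ (0 mod p) ≡ 0
  toℕ-0-mod = ≡.trans (toℕ-fromℕ< (m%n<n 0 p)) (m<n⇒m%n≡m (>-nonZero⁻¹ p))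

  nonzero : Fin (pred (p ^ m)) → Vector (Fin p) m
  nonzero c = finToFun (avoid zeroCode c)

  nonzero-≢0 : ∀ c → ¬ IsZero (nonzero c)
  nonzero-≢0 c isZero = avoid-≢ zeroCode c (≡.trans (≡.sym (funToFin-finToFin {m} {p} (avoid zeroCode c)))
    (funToFin-cong λ i → toℕ-injective (≡.trans (isZero i) (≡.sym toℕ-0-mod))))

  nonzero-surjective : ∀ {κ} → ¬ IsZero κ → ∃ λ c → nonzero c ≗ κ
  nonzero-surjective {κ} κ≢0 = proj₁ preimage , λ i →
    ≡.trans (cong (λ k → finToFun k i) (proj₂ preimage)) (finToFun-funToFin κ i)
    where
    preimage = avoid-surjective {z = zeroCode} {i = funToFin κ} λ eq → κ≢0 λ i → begin
      toℕ (κ i)                             ≡⟨ cong toℕ (finToFun-funToFin κ i) ⟨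
      toℕ (finToFun {p} (funToFin κ) i)     ≡⟨ cong (λ k → toℕ (finToFun {p} {m} k i)) eq ⟨
      toℕ (finToFun {p} {m} zeroCode i)     ≡⟨ cong toℕ (finToFun-funToFin {m} {p} (λ _ → 0 mod p) i) ⟩
      toℕ (0 mod p)                         ≡⟨ toℕ-0-mod ⟩
      0                                     ∎
      where open ≡.≡-Reasoning

^-cancelʳ-≤ : ∀ p .{{_ : NonZero p}} → 1 < p → ∀ {m n} → p ^ m ≤ p ^ n → m ≤ n
^-cancelʳ-≤ p 1<p le = ℕ.≮⇒≥ λ n<m → ℕ.<-irrefl ≡.refl (ℕ.<-≤-trans (ℕ.^-monoʳ-< p 1<p n<m) le)

-- Listing the points of a pattern

lookup-injective : ∀ {a} {X : Set a} {xs : List X} → Unique xs →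
                   ∀ i j → lookup xs i ≡ lookup xs j → i ≡ j
lookup-injective (_ ∷ _)       zero    zero    _  = ≡.refl
lookup-injective (x∉xs ∷ _)    zero    (suc j) eq = contradiction eq (All.lookup x∉xs (∈-lookup j))
lookup-injective (x∉xs ∷ _)    (suc i) zero    eq = contradiction (≡.sym eq) (All.lookup x∉xs (∈-lookup i))
lookup-injective (_ ∷ unique)  (suc i) (suc j) eq = cong suc (lookup-injective unique i j eq)

module _ {s t : ℕ} {S : Pred (Torus s t) 0ℓ} (S? : Decidable S) where

  elements-unique : Unique (elements S?)
  elements-unique = Unique.filter⁺ S? (Unique.cartesianProduct⁺ (Unique.allFin⁺ s) (Unique.allFin⁺ t))

  ∈-elements⁺ : ∀ {x} → x ∈ S → x ∈ₗ elements S?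
  ∈-elements⁺ {i , j} = ∈-filter⁺ S? (∈-cartesianProduct⁺ (∈-allFin i) (∈-allFin j))

  ∈-elements⁻ : ∀ {x} → x ∈ₗ elements S? → x ∈ S
  ∈-elements⁻ = proj₂ ∘ ∈-filter⁻ S? {xs = cartesianProduct (allFin s) (allFin t)}

-- Two lists without repetition and with the same members are permutations of each other. Equality
-- is too much to ask: `elements` follows the fixed order of the torus, in which the points of the
-- two sets interleave.
elements-∪-image : ∀ {s t} {f : Torus s t → Torus s t} → (∀ {x y} → f x ≡ f y → x ≡ y) →
                   {S₁ S₂ : Pred (Torus s t) 0ℓ} (S₁? : Decidable S₁) (S₂? : Decidable S₂) →
                   Image f S₂ ⊥ S₁ →
                   elements (S₁? ∪? image? f S₂?) ↭ elements S₁? ++ map f (elements S₂?)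
elements-∪-image {f = f} f-injective S₁? S₂? disjoint =
  ∼bag⇒↭ (unique∧set⇒bag (elements-unique _)
    (Unique.++⁺ (elements-unique S₁?) (Unique.map⁺ f-injective (elements-unique S₂?)) disjointLists)
    (mk⇔ forward backward))
  where
  image⁻ : ∀ {y} → y ∈ₗ map f (elements S₂?) → y ∈ Image f _
  image⁻ y∈ with x , x∈ , y≡fx ← ∈-map⁻ f y∈ = x , ∈-elements⁻ S₂? x∈ , ≡.sym y≡fx

  disjointLists : ∀ {y} → ¬ (y ∈ₗ elements S₁? × y ∈ₗ map f (elements S₂?))
  disjointLists (y∈₁ , y∈₂) = disjoint (image⁻ y∈₂ , ∈-elements⁻ S₁? y∈₁)

  forward : ∀ {y} → y ∈ₗ elements (S₁? ∪? image? f S₂?) → y ∈ₗ elements S₁? ++ map f (elements S₂?)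
  forward y∈ with ∈-elements⁻ (S₁? ∪? image? f S₂?) y∈
  ... | inj₁ y∈S₁                = ∈-++⁺ˡ (∈-elements⁺ S₁? y∈S₁)
  ... | inj₂ (x , x∈S₂ , ≡.refl) = ∈-++⁺ʳ _ (∈-map⁺ f (∈-elements⁺ S₂? x∈S₂))

  backward : ∀ {y} → y ∈ₗ elements S₁? ++ map f (elements S₂?) → y ∈ₗ elements (S₁? ∪? image? f S₂?)
  backward y∈ with ∈-++⁻ (elements S₁?) y∈
  ... | inj₁ y∈₁ = ∈-elements⁺ (S₁? ∪? image? f S₂?) (inj₁ (∈-elements⁻ S₁? y∈₁))
  ... | inj₂ y∈₂ = ∈-elements⁺ (S₁? ∪? image? f S₂?) (inj₂ (image⁻ y∈₂))

-- Powers, apartness and sums in a Heyting field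

module FieldProperties {c ℓ₁ ℓ₂} (F : HeytingField c ℓ₁ ℓ₂) where

  open HeytingField F using (Carrier; _#_; tight; #⇒invertible; heytingCommutativeRing) public
  open CommutativeRing (HeytingCommutativeRing.commutativeRing heytingCommutativeRing)
    using (_≈_; 0#; 1#; refl; sym; trans; reflexive; setoid; semiring; ring
          ; zeroˡ; zeroʳ; *-identityˡ; *-identityʳ; *-assoc; *-congˡ; *-congʳ; *-cong
          ; +-cong; +-congˡ; +-congʳ; +-identityˡ; +-identityʳ; +-assoc
          ; +-commutativeSemigroup; *-commutativeSemigroup) public
    renaming (_+_ to _+F_; _*_ to _*F_)
  open FieldNotions F public
  open HeytingProperties heytingCommutativeRing using (1#0; x-0≈x; x#0y#0→xy#0) public
  open RingProperties ring using () renaming (+-cancelˡ to +F-cancelˡ) public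
  open SemiringExp semiring using (^-homo-*; ^-assocʳ) public
  open SemiringMult semiring using (×-comm-*; ×-assoc-*; ×1-homo-*; ×-homo-+; ×-assocˡ; ×-congʳ) public
  open SemiringSum semiring
    using (sum-cong-≋; ∑-distrib-+; sum-replicate; sum-replicate-zero; sum-permute; *-distribˡ-sum) public
  open SetoidReasoning setoid

  *-cancelˡ-# : ∀ {x y z} → x # 0# → x *F y ≈ x *F z → y ≈ z
  *-cancelˡ-# {x} {y} {z} x#0 xy≈xz with x⁻¹ , x⁻¹x≈1 , _ ← #⇒invertible x#0 = begin
    y                ≈⟨ leftInverse y ⟨
    x⁻¹ *F (x *F y)  ≈⟨ *-congˡ xy≈xz ⟩
    x⁻¹ *F (x *F z)  ≈⟨ leftInverse z ⟩
    z                ∎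
    where
    leftInverse : ∀ w → x⁻¹ *F (x *F w) ≈ w
    leftInverse w = begin
      x⁻¹ *F (x *F w)  ≈⟨ *-assoc x⁻¹ x w ⟨
      -- The inverse obtained from `x # 0#` is an inverse of the difference of `x` and `0#`.
      (x⁻¹ *F x) *F w  ≈⟨ *-congʳ (trans (*-congˡ (sym (x-0≈x x))) x⁻¹x≈1) ⟩
      1# *F w          ≈⟨ *-identityˡ w ⟩
      w                ∎

  #⇒≉ : ∀ {x} → x # 0# → ¬ x ≈ 0#
  #⇒≉ x#0 x≈0 = proj₂ (tight _ _) x≈0 x#0

  -- Tightness turns failure of apartness into equality, so its contrapositive gives a double
  -- negation only. That is enough wherever the goal is decidable.
  ≉⇒¬¬# : ∀ {x} → ¬ x ≈ 0# → ¬ ¬ x # 0#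
  ≉⇒¬¬# x≉0 ¬x#0 = x≉0 (proj₁ (tight _ _) ¬x#0)

  ^-#0 : ∀ {x} → x # 0# → ∀ k → (x ^F k) # 0#
  ^-#0 x#0 zero    = 1#0
  ^-#0 x#0 (suc k) = x#0y#0→xy#0 x#0 (^-#0 x#0 k)

  ^-one : ∀ {x} → x ≈ 1# → ∀ k → x ^F k ≈ 1#
  ^-one x≈1 zero    = refl
  ^-one x≈1 (suc k) = trans (*-cong x≈1 (^-one x≈1 k)) (*-identityˡ 1#)

  ^-% : ∀ {x} d .{{_ : NonZero d}} → x ^F d ≈ 1# → ∀ k → x ^F k ≈ x ^F (k % d)
  ^-% {x} d xᵈ≈1 k = begin
    x ^F k                                ≡⟨ cong (x ^F_) (m≡m%n+[m/n]*n k d) ⟩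
    x ^F (k % d + k / d * d)              ≈⟨ ^-homo-* x (k % d) (k / d * d) ⟩
    x ^F (k % d) *F x ^F (k / d * d)      ≡⟨ cong (λ e → x ^F (k % d) *F x ^F e) (ℕ.*-comm (k / d) d) ⟩
    x ^F (k % d) *F x ^F (d * (k / d))    ≈⟨ *-congˡ (^-assocʳ x d (k / d)) ⟨
    x ^F (k % d) *F (x ^F d) ^F (k / d)   ≈⟨ *-congˡ (^-one xᵈ≈1 (k / d)) ⟩
    x ^F (k % d) *F 1#                    ≈⟨ *-identityʳ _ ⟩
    x ^F (k % d)                          ∎

  -- Concatenation and permutation act on the list itself here, whereas `sum` over positions would
  -- call for reindexing.
  listSum : ∀ {a} {X : Set a} → (X → Carrier) → List X → Carrier
  listSum f []       = 0#
  listSum f (x ∷ xs) = f x +F listSum f xs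

  module _ {a} {X : Set a} (f : X → Carrier) where

    sum-lookup : ∀ xs → sum (f ∘ lookup xs) ≈ listSum f xs
    sum-lookup []       = refl
    sum-lookup (x ∷ xs) = +-congˡ (sum-lookup xs)

    listSum-++ : ∀ xs ys → listSum f (xs ++ ys) ≈ listSum f xs +F listSum f ys
    listSum-++ []       ys = sym (+-identityˡ _)
    listSum-++ (x ∷ xs) ys = trans (+-congˡ (listSum-++ xs ys)) (sym (+-assoc _ _ _))

    listSum-map : ∀ {b} {Y : Set b} (g : Y → X) ys → listSum f (map g ys) ≈ listSum (f ∘ g) ys
    listSum-map g []       = refl
    listSum-map g (y ∷ ys) = +-congˡ (listSum-map g ys)

    listSum-↭ : ∀ {xs ys} → xs ↭ ys → listSum f xs ≈ listSum f ys
    listSum-↭ ↭-refl        = refl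
    listSum-↭ (prep x p)    = +-congˡ (listSum-↭ p)
    listSum-↭ (swap x y p)  = trans (+-congˡ (+-congˡ (listSum-↭ p))) (x∙yz≈y∙xz (f x) (f y) _)
      where open CommutativeSemigroupProperties +-commutativeSemigroup using (x∙yz≈y∙xz)
    listSum-↭ (↭-trans p q) = trans (listSum-↭ p) (listSum-↭ q)

  lc : ∀ {m} → (Fin m → ℕ) → Vector Carrier m → Carrier
  lc f v = sum λ i → f i ×F v i

  lc-+ : ∀ {m} (f g : Fin m → ℕ) v → lc (λ i → f i + g i) v ≈ lc f v +F lc g v
  lc-+ f g v = trans (sum-cong-≋ λ i → ×-homo-+ (v i) (f i) (g i)) (∑-distrib-+ (λ i → f i ×F v i) (λ i → g i ×F v i))

  single : ∀ {m} → ℕ → Fin m → Fin m → ℕ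
  single k zero    zero    = k
  single k zero    (suc j) = 0
  single k (suc i) zero    = 0
  single k (suc i) (suc j) = single k i j

  single-diag : ∀ {m} k (i : Fin m) → single k i i ≡ k
  single-diag k zero    = ≡.refl
  single-diag k (suc i) = single-diag k i

  lc-single : ∀ {m} k (i : Fin m) v → lc (single k i) v ≈ k ×F v i
  lc-single {suc m} k zero    v = trans (+-congˡ (sum-replicate-zero m)) (+-identityʳ _)
  lc-single {suc m} k (suc i) v = trans (+-identityˡ _) (lc-single k i (v ∘ suc))

-- Consequences of finiteness: decidable equality, cancellation, annihilation by the cardinality

module FiniteFieldProperties {c ℓ₁ ℓ₂} (F : HeytingField c ℓ₁ ℓ₂) (q : ℕ)
  (card : FieldNotions.HasCardinality F q) where

  open FieldProperties F public
  open SetoidReasoning setoid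

  open Inverse card using (to; from; to-cong; strictlyInverseˡ; strictlyInverseʳ) public

  to-injective : ∀ {x y} → to x ≡ to y → x ≈ y
  to-injective {x} {y} eq = begin
    x            ≈⟨ strictlyInverseʳ x ⟨
    from (to x)  ≡⟨ cong from eq ⟩
    from (to y)  ≈⟨ strictlyInverseʳ y ⟩
    y            ∎

  from-injective : ∀ {i j} → from i ≈ from j → i ≡ j
  from-injective {i} {j} eq =
    ≡.trans (≡.sym (strictlyInverseˡ i)) (≡.trans (to-cong eq) (strictlyInverseˡ j))

  infix 4 _≈?_
  _≈?_ : ∀ x y → Dec (x ≈ y)
  x ≈? y = map′ to-injective to-cong (to x ≟ to y)

  *-cancelˡ-≉ : ∀ {x y z} → ¬ x ≈ 0# → x *F y ≈ x *F z → y ≈ z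
  *-cancelˡ-≉ x≉0 xy≈xz =
    decidable-stable (_ ≈? _) λ y≉z → ≉⇒¬¬# x≉0 λ x#0 → y≉z (*-cancelˡ-# x#0 xy≈xz)

  *-cancelʳ-≉ : ∀ {x y z} → ¬ x ≈ 0# → y *F x ≈ z *F x → y ≈ z
  *-cancelʳ-≉ x≉0 yx≈zx = *-cancelˡ-≉ x≉0 (trans (*F-comm _ _) (trans yx≈zx (*F-comm _ _)))
    where open HeytingField F using () renaming (*-comm to *F-comm)

  -- Translation by x permutes the field, so it preserves the sum of all elements.
  q×x≈0 : ∀ x → q ×F x ≈ 0#
  q×x≈0 x = +F-cancelˡ (sum from) _ _ (begin
    sum from +F q ×F x            ≈⟨ +-congˡ (sum-replicate q) ⟨
    sum from +F sum {q} (λ _ → x) ≈⟨ ∑-distrib-+ from (λ _ → x) ⟨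
    sum (λ i → from i +F x)       ≈⟨ sum-cong-≋ (λ i → sym (strictlyInverseʳ (from i +F x))) ⟩
    sum (λ i → from (shift x i))  ≈⟨ sum-permute from (permutation (shift x) (shift (- x))
                                       (shift-shift (-‿inverseˡ x)) (shift-shift (-‿inverseʳ x))) ⟨
    sum from                      ≈⟨ +-identityʳ _ ⟨
    sum from +F 0#                ∎)
    where
    open HeytingField F using (-_; -‿inverseˡ; -‿inverseʳ)
    shift : Carrier → Fin q → Fin q
    shift y i = to (from i +F y)
    shift-shift : ∀ {y z} → y +F z ≈ 0# → ∀ i → shift z (shift y i) ≡ i
    shift-shift {y} {z} y+z≈0 i = ≡.trans (to-cong (begin
      from (to (from i +F y)) +F z  ≈⟨ +-congʳ (strictlyInverseʳ _) ⟩
      (from i +F y) +F z            ≈⟨ +-assoc _ _ _ ⟩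
      from i +F (y +F z)            ≈⟨ +-congˡ y+z≈0 ⟩
      from i +F 0#                  ≈⟨ +-identityʳ _ ⟩
      from i                        ∎)) (strictlyInverseˡ i)

  -- The order of a generator

  module Generator {α : Carrier} (gen : GeneratesUnits α) (N : ℕ) (q≡1+N : q ≡ suc N) where

    α#0 : α # 0#
    α#0 = proj₁ gen

    -- An exponent that reaches `j` drops back to `i`, so multiplication by `α` never leads out of
    -- the first `j` powers.
    power-< : ∀ {i j} → i < j → α ^F i ≈ α ^F j → ∀ k → ∃ λ r → r < j × α ^F r ≈ α ^F k
    power-< {j = suc j} i<j eq zero = 0 , s≤s z≤n , refl
    power-< {i} i<j eq (suc k) with r , r<j , eqᵣ ← power-< i<j eq k | ℕ.m≤n⇒m<n∨m≡n r<j
    ... | inj₁ 1+r<j  = suc r , 1+r<j , *-congˡ eqᵣ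
    ... | inj₂ ≡.refl = i , i<j , trans eq (*-congˡ eqᵣ)

    -- Otherwise `0#` and the first `j` powers would exhaust the field, which has more than `suc j`
    -- elements.
    powers-injective : ∀ {i j} → i < j → j < N → ¬ α ^F i ≈ α ^F j
    powers-injective {i} {j} i<j j<N eq = <⇒notInjective 1+j<q code-injective
      where
      element : Fin (suc j) → Carrier
      element zero    = 0#
      element (suc r) = α ^F toℕ r

      exponent : ∀ {x} → x # 0# → ∃ λ r → element r ≈ x
      exponent x#0 with k , αᵏ≈x ← proj₂ gen _ x#0 with r , r<j , αʳ≈αᵏ ← power-< i<j eq k =
        suc (fromℕ< r<j) , trans (reflexive (cong (α ^F_) (toℕ-fromℕ< r<j))) (trans αʳ≈αᵏ αᵏ≈x)

      code : ∀ x → ∃ λ r → element r ≈ x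
      code x with x ≈? 0#
      ... | yes x≈0 = zero , sym x≈0
      -- `exponent` asks for apartness from zero, known only up to double negation. The existence of
      -- a code is a finite search, hence decidable, which removes the double negation.
      ... | no  x≉0 = decidable-stable (any? λ r → element r ≈? x)
                        λ none → ≉⇒¬¬# x≉0 (none ∘ exponent)

      code-injective : ∀ {a b} → proj₁ (code (from a)) ≡ proj₁ (code (from b)) → a ≡ b
      code-injective {a} {b} same = from-injective (begin
        from a                            ≈⟨ proj₂ (code (from a)) ⟨
        element (proj₁ (code (from a)))   ≡⟨ cong element same ⟩
        element (proj₁ (code (from b)))   ≈⟨ proj₂ (code (from b)) ⟩
        from b                            ∎)

      1+j<q : suc j < q
      1+j<q = subst (suc j <_) (≡.sym q≡1+N) (s≤s j<N)

    -- Zero and the powers with exponents 0 to N are one more than the field can hold. A collision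
    -- cannot involve zero, nor two exponents below N. So one exponent is N, and the other is 0,
    -- since otherwise cancelling `α` would give a collision below N.
    αᴺ≈1 : α ^F N ≈ 1#
    αᴺ≈1 = collision (pigeonhole (subst (_< suc (suc N)) (≡.sym q≡1+N) (ℕ.n<1+n _)) element)
      where
      element : Fin (suc (suc N)) → Fin q
      element zero    = to 0#
      element (suc k) = to (α ^F toℕ k)

      period : ∀ i j → i < j → j ≤ N → α ^F i ≈ α ^F j → α ^F N ≈ 1#
      period i j i<j j≤N eq with ℕ.m≤n⇒m<n∨m≡n j≤N
      ... | inj₁ j<N = contradiction eq (powers-injective i<j j<N)
      period zero    j       i<j       j≤N eq | inj₂ ≡.refl = sym eq
      period (suc i) (suc j) (s≤s i<j) j≤N eq | inj₂ ≡.refl =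
        contradiction (*-cancelˡ-# α#0 eq) (powers-injective i<j (ℕ.n<1+n j))

      collision : (∃₂ λ i j → toℕ i < toℕ j × element i ≡ element j) → α ^F N ≈ 1#
      collision (zero  , suc j , _ , eq)       = contradiction (sym (to-injective eq)) (#⇒≉ (^-#0 α#0 (toℕ j)))
      collision (suc i , suc j , s≤s i<j , eq) =
        period (toℕ i) (toℕ j) i<j (ℕ.≤-pred (toℕ<n j)) (to-injective eq)

    ^-injective-% : .{{_ : NonZero N}} → ∀ {k l} → α ^F k ≈ α ^F l → k % N ≡ l % N
    ^-injective-% {k} {l} eq with ℕ.<-cmp (k % N) (l % N)
    ... | tri≈ _ same _ = same
    ... | tri< lt _ _ = contradiction reduced (powers-injective lt (m%n<n l N))
      where reduced = trans (sym (^-% N αᴺ≈1 k)) (trans eq (^-% N αᴺ≈1 l))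
    ... | tri> _ _ gt = contradiction (sym reduced) (powers-injective gt (m%n<n k N))
      where reduced = trans (sym (^-% N αᴺ≈1 k)) (trans eq (^-% N αᴺ≈1 l))

  -- The torus inside the unit group

  module Lattice {α : Carrier} (gen : GeneratesUnits α) (s t : ℕ) .{{_ : NonZero s}} .{{_ : NonZero t}}
                 (q≡1+st : q ≡ suc (s * t)) (coprime : Coprime s t) where

    open Generator gen (s * t) q≡1+st

    private
      instance
        st≢0 : NonZero (s * t)
        st≢0 = ℕ.m*n≢0 s t

      a : Torus s t → Carrier
      a = A (α ^F t) (α ^F s)

    a≈α^ : ∀ i j → a (i , j) ≈ α ^F (t * toℕ i + s * toℕ j)
    a≈α^ i j = begin
      (α ^F t) ^F toℕ i *F (α ^F s) ^F toℕ j    ≈⟨ *-cong (^-assocʳ α t (toℕ i)) (^-assocʳ α s (toℕ j)) ⟩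
      α ^F (t * toℕ i) *F α ^F (s * toℕ j)      ≈⟨ ^-homo-* α (t * toℕ i) (s * toℕ j) ⟨
      α ^F (t * toℕ i + s * toℕ j)              ∎

    A-injective : ∀ {x y} → a x ≈ a y → x ≡ y
    A-injective {i , j} {i′ , j′} eq = cong₂ _,_
      (toℕ-injective (remainder-injective coprime (toℕ<n i) (toℕ<n i′) exponents))
      (toℕ-injective (remainder-injective {t} {s} {{st≢0 = ℕ.m*n≢0 t s}}
        (Coprimality.sym coprime) (toℕ<n j) (toℕ<n j′) flipped))
      where
      exponents : (t * toℕ i + s * toℕ j) % (s * t) ≡ (t * toℕ i′ + s * toℕ j′) % (s * t)
      exponents = ^-injective-% (trans (sym (a≈α^ i j)) (trans eq (a≈α^ i′ j′)))

      flip : ∀ k l → _%_ (s * l + t * k) (t * s) {{ℕ.m*n≢0 t s}} ≡ (t * k + s * l) % (s * t)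
      flip k l = ≡.trans (%-congʳ {{ℕ.m*n≢0 t s}} (ℕ.*-comm t s)) (cong (_% (s * t)) (ℕ.+-comm (s * l) (t * k)))

      flipped = ≡.trans (flip (toℕ i) (toℕ j)) (≡.trans exponents (≡.sym (flip (toℕ i′) (toℕ j′))))

    A#0 : ∀ x → a x # 0#
    A#0 (i , j) = x#0y#0→xy#0 (^-#0 (^-#0 α#0 t) (toℕ i)) (^-#0 (^-#0 α#0 s) (toℕ j))

    βˢ≈1 : (α ^F t) ^F s ≈ 1#
    βˢ≈1 = trans (^-assocʳ α t s) (trans (reflexive (cong (α ^F_) (ℕ.*-comm t s))) αᴺ≈1)

    γᵗ≈1 : (α ^F s) ^F t ≈ 1#
    γᵗ≈1 = trans (^-assocʳ α s t) αᴺ≈1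

    ^-mod : ∀ {x} d .{{_ : NonZero d}} → x ^F d ≈ 1# → ∀ k l → x ^F toℕ ((k + l) mod d) ≈ x ^F l *F x ^F k
    ^-mod {x} d xᵈ≈1 k l = begin
      x ^F toℕ ((k + l) mod d)  ≡⟨ cong (x ^F_) (toℕ-fromℕ< (m%n<n (k + l) d)) ⟩
      x ^F ((k + l) % d)        ≈⟨ ^-% d xᵈ≈1 (k + l) ⟨
      x ^F (k + l)              ≡⟨ cong (x ^F_) (ℕ.+-comm k l) ⟩
      x ^F (l + k)              ≈⟨ ^-homo-* x l k ⟩
      x ^F l *F x ^F k          ∎

    -- Wrapping around the torus changes no value because β^s = γ^t = 1. This is what turns toroidal
    -- translation into multiplication by a single unit.
    A-T : ∀ i j x → a (T i j x) ≈ a (i , j) *F a x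
    A-T i j (k , l) = trans (*-cong (^-mod s βˢ≈1 (toℕ k) (toℕ i)) (^-mod t γᵗ≈1 (toℕ l) (toℕ j)))
                            (interchange _ _ _ _)
      where open CommutativeSemigroupProperties *-commutativeSemigroup using (interchange)

    -- Carried over to the field, where the claim is cancellation of a unit.
    T-injective : ∀ (i : Fin s) (j : Fin t) {x y} → T i j x ≡ T i j y → x ≡ y
    T-injective i j {x} {y} eq = A-injective (*-cancelˡ-# (A#0 (i , j))
      (trans (sym (A-T i j x)) (trans (reflexive (cong a eq)) (A-T i j y))))

  -- Linear algebra over the prime field by counting

  module LinearAlgebra (p : ℕ) (p-prime : Prime p) (n : ℕ) (q≡pⁿ : q ≡ p ^ n) where

    open Over p public

    instance
      p≢0 : NonZero p
      p≢0 = prime⇒nonZero p-prime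

    1<p : 1 < p
    1<p = nonTrivial⇒n>1 p {{prime⇒nonTrivial p-prime}}

    -- The power p^n annihilates 1, and its multiple of 1 is a product of copies of p times 1. A
    -- nonzero factor can be cancelled; if all were cancelled, 1 would be 0.
    p×1≈0 : p ×F 1# ≈ 0#
    p×1≈0 = root n (subst (λ k → k ×F 1# ≈ 0#) q≡pⁿ (q×x≈0 1#))
      where
      root : ∀ k → (p ^ k) ×F 1# ≈ 0# → p ×F 1# ≈ 0#
      root zero    1×1≈0 = contradiction (trans (sym (+-identityʳ 1#)) 1×1≈0) (#⇒≉ 1#0)
      root (suc k) eq with p ×F 1# ≈? 0#
      ... | yes p×1≈0 = p×1≈0
      ... | no  p×1≉0 = root k (*-cancelˡ-≉ p×1≉0 (begin
        (p ×F 1#) *F ((p ^ k) ×F 1#)  ≈⟨ ×1-homo-* p (p ^ k) ⟨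
        (p ^ suc k) ×F 1#             ≈⟨ eq ⟩
        0#                            ≈⟨ zeroʳ _ ⟨
        (p ×F 1#) *F 0#               ∎))

    p×x≈0 : ∀ x → p ×F x ≈ 0#
    p×x≈0 x = begin
      p ×F x          ≈⟨ ×-congʳ p (*-identityˡ x) ⟨
      p ×F (1# *F x)  ≈⟨ ×-assoc-* p 1# x ⟨
      (p ×F 1#) *F x  ≈⟨ *-congʳ p×1≈0 ⟩
      0# *F x         ≈⟨ zeroˡ x ⟩
      0#              ∎

    ∣⇒×≈0 : ∀ {k} → p ∣ k → ∀ x → k ×F x ≈ 0#
    ∣⇒×≈0 (divides m ≡.refl) x = begin
      (m * p) ×F x  ≡⟨ cong (_×F x) (ℕ.*-comm m p) ⟩
      (p * m) ×F x  ≈⟨ ×-assocˡ x p m ⟨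
      p ×F (m ×F x) ≈⟨ p×x≈0 _ ⟩
      0#            ∎

    ×-% : ∀ k x → k ×F x ≈ (k % p) ×F x
    ×-% k x = begin
      k ×F x                              ≡⟨ cong (_×F x) (m≡m%n+[m/n]*n k p) ⟩
      (k % p + k / p * p) ×F x            ≈⟨ ×-homo-+ x (k % p) (k / p * p) ⟩
      (k % p) ×F x +F (k / p * p) ×F x    ≈⟨ +-congˡ (∣⇒×≈0 (n∣m*n (k / p)) x) ⟩
      (k % p) ×F x +F 0#                  ≈⟨ +-identityʳ _ ⟩
      (k % p) ×F x                        ∎

    lc-∣ : ∀ {m} {f : Fin m → ℕ} → (∀ i → p ∣ f i) → ∀ v → lc f v ≈ 0#
    lc-∣ {m} p∣f v = trans (sum-cong-≋ λ i → ∣⇒×≈0 (p∣f i) (v i)) (sum-replicate-zero m)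

    residue : ∀ {m} → (Fin m → ℕ) → Vector (Fin p) m
    residue f i = f i mod p

    toℕ-residue : ∀ {m} (f : Fin m → ℕ) i → toℕ (residue f i) ≡ f i % p
    toℕ-residue f i = toℕ-fromℕ< (m%n<n (f i) p)

    residue-zero⇒∣ : ∀ {m} {f : Fin m → ℕ} → IsZero (residue f) → ∀ i → p ∣ f i
    residue-zero⇒∣ {f = f} isZero i =
      m%n≡0⇒n∣m (f i) p (≡.trans (≡.sym (toℕ-residue f i)) (isZero i))

    lc-residue : ∀ {m} (f : Fin m → ℕ) v → lc f v ≈ linearCombination (residue f) v
    lc-residue f v = sum-cong-≋ λ i →
      trans (×-% (f i) (v i)) (reflexive (cong (_×F v i) (≡.sym (toℕ-residue f i))))

    linearCombination-cong : ∀ {m} {κ κ′ : Vector (Fin p) m} → κ ≗ κ′ → ∀ v →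
                             linearCombination κ v ≈ linearCombination κ′ v
    linearCombination-cong κ≗κ′ v = sum-cong-≋ λ i → reflexive (cong (λ k → toℕ k ×F v i) (κ≗κ′ i))

    independent⇒∣ : ∀ {m} {v : Vector Carrier m} → LinearlyIndependent v →
                    ∀ f → lc f v ≈ 0# → ∀ i → p ∣ f i
    independent⇒∣ {v = v} ind f eq =
      residue-zero⇒∣ (ind (residue f) (trans (sym (lc-residue f v)) eq))

    -- The two vectors are subtracted with `p ∸ toℕ (κ′ j)` as the negative of `κ′ j`. This may be
    -- `p` itself, which does no harm since `p` acts as zero.
    independent⇒injective : ∀ {m} {v : Vector Carrier m} → LinearlyIndependent v → ∀ κ κ′ →
                            linearCombination κ v ≈ linearCombination κ′ v → κ ≗ κ′
    independent⇒injective {m} {v} ind κ κ′ eq i =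
      toℕ-injective (∣m+[d∸n]⇒≡ (toℕ<n (κ i)) (toℕ<n (κ′ i)) (independent⇒∣ ind (λ j → toℕ (κ j) + -κ′ j) vanishes i))
      where
      -κ′ : Fin m → ℕ
      -κ′ j = p ∸ toℕ (κ′ j)

      κ′-κ′≡p : ∀ j → toℕ (κ′ j) + -κ′ j ≡ p
      κ′-κ′≡p j = ℕ.m+[n∸m]≡n (ℕ.<⇒≤ (toℕ<n (κ′ j)))

      vanishes : lc (λ j → toℕ (κ j) + -κ′ j) v ≈ 0#
      vanishes = begin
        lc (λ j → toℕ (κ j) + -κ′ j) v     ≈⟨ lc-+ (toℕ ∘ κ) -κ′ v ⟩
        lc (toℕ ∘ κ) v +F lc -κ′ v         ≈⟨ +-congʳ eq ⟩
        lc (toℕ ∘ κ′) v +F lc -κ′ v        ≈⟨ lc-+ (toℕ ∘ κ′) -κ′ v ⟨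
        lc (λ j → toℕ (κ′ j) + -κ′ j) v    ≈⟨ lc-∣ (λ j → subst (p ∣_) (≡.sym (κ′-κ′≡p j)) ∣-refl) v ⟩
        0#                                 ∎

    -- Counting replaces an exchange argument: the `p ^ m` combinations of `v` are distinct, and
    -- each is named by one of `p ^ d` coordinate vectors.
    independent⇒≤dimension : ∀ {m d} {v : Vector Carrier m} → LinearlyIndependent v →
                             HasDimension (Span v) d → m ≤ d
    independent⇒≤dimension {m} {d} {v} ind dim = ^-cancelʳ-≤ p 1<p (injective⇒≤ code-injective)
      where
      open HasDimension dim

      coordinates : (k : Fin (p ^ m)) → linearCombination (finToFun k) v ∈ Span basis
      coordinates k = spanning (finToFun k , refl)

      code : Fin (p ^ m) → Fin (p ^ d)
      code k = funToFin (proj₁ (coordinates k))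

      code-injective : ∀ {k l} → code k ≡ code l → k ≡ l
      code-injective {k} {l} eq = ≡.trans (≡.sym (funToFin-finToFin {m} {p} k)) (≡.trans
        (funToFin-cong (independent⇒injective ind (finToFun k) (finToFun l) (begin
          linearCombination (finToFun k) v                ≈⟨ proj₂ (coordinates k) ⟩
          linearCombination (proj₁ (coordinates k)) basis ≈⟨ linearCombination-cong same basis ⟩
          linearCombination (proj₁ (coordinates l)) basis ≈⟨ proj₂ (coordinates l) ⟨
          linearCombination (finToFun l) v                ∎)))
        (funToFin-finToFin {m} {p} l))
        where
        same : proj₁ (coordinates k) ≗ proj₁ (coordinates l)
        same i = ≡.trans (≡.sym (finToFun-funToFin (proj₁ (coordinates k)) i))
          (≡.trans (cong (λ c → finToFun c i) eq) (finToFun-funToFin (proj₁ (coordinates l)) i))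

    -- The count is run by contradiction: were every index bad, sending it to its pair of nonzero
    -- coefficient vectors would inject `Fin N` into a smaller set. Badness being decidable, a good
    -- index is then found by search.
    ∃-jointly-independent :
      ∀ {m₁ m₂ N} {v : Vector Carrier m₁} {w : Vector Carrier m₂} →
      LinearlyIndependent v → LinearlyIndependent w → m₁ + m₂ ≤ n → 0 < N → p ^ n ≡ suc N →
      (u : Fin N → Carrier) → (∀ i → u i # 0#) → (∀ {i j} → u i ≈ u j → i ≡ j) →
      ∃ λ i → ∀ f g → lc f v +F u i *F lc g w ≈ 0# → (∀ a → p ∣ f a) × (∀ b → p ∣ g b)
    ∃-jointly-independent {m₁} {m₂} {N} {v} {w} ind₁ ind₂ m₁+m₂≤n 0<N pⁿ≡1+N u u#0 u-injective =
      proj₁ good , independent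
      where
      Bad : Fin N → Set _
      Bad i = ∃ λ a → ∃ λ b →
        linearCombination (nonzero {p} {m₁} a) v +F u i *F linearCombination (nonzero {p} {m₂} b) w ≈ 0#

      bad? : ∀ i → Dec (Bad i)
      bad? i = any? λ a → any? λ b → _ ≈? 0#

      pairs<N : pred (p ^ m₁) * pred (p ^ m₂) < N
      pairs<N = pred*pred< (p ^ m₁) (p ^ m₂) 0<N (subst (p ^ m₁ * p ^ m₂ ≤_) pⁿ≡1+N
        (subst (_≤ p ^ n) (ℕ.^-distribˡ-+-* p m₁ m₂) (ℕ.^-monoʳ-≤ p m₁+m₂≤n)))

      not-all-bad : ¬ (∀ i → Bad i)
      not-all-bad bad = <⇒notInjective pairs<N injective
        where
        injective : ∀ {i j} → combine (proj₁ (bad i)) (proj₁ (proj₂ (bad i))) ≡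
                              combine (proj₁ (bad j)) (proj₁ (proj₂ (bad j))) → i ≡ j
        injective {i} {j} eq with bad i | bad j
        ... | a , b , eqᵢ | a′ , b′ , eqⱼ with combine-injective a b a′ b′ eq
        -- The equations now share their `v`-part, which cancels additively, and their `w`-part,
        -- which is nonzero by independence and cancels as a factor.
        ... | ≡.refl , ≡.refl = u-injective (*-cancelʳ-≉ (nonzero-≢0 b ∘ ind₂ (nonzero b))
                                  (+F-cancelˡ _ _ _ (trans eqᵢ (sym eqⱼ))))

      good : ∃ λ i → ¬ Bad i
      good = ¬∀⟶∃¬ N Bad bad? not-all-bad

      zero? : ∀ {m} (κ : Vector (Fin p) m) → Dec (IsZero κ)
      zero? κ = all? λ i → toℕ (κ i) ℕ.≟ 0

      independent : ∀ f g → lc f v +F u (proj₁ good) *F lc g w ≈ 0# →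
                    (∀ a → p ∣ f a) × (∀ b → p ∣ g b)
      -- Badness concerns pairs of vectors that are both nonzero modulo `p`. If one vanishes, the
      -- independence of the other family settles the claim.
      independent f g eq with zero? (residue f) | zero? (residue g)
      ... | yes f≡0 | _ = residue-zero⇒∣ f≡0 , independent⇒∣ ind₂ g (*-cancelˡ-# (u#0 _) (begin
        u (proj₁ good) *F lc g w            ≈⟨ +-identityˡ _ ⟨
        0# +F u (proj₁ good) *F lc g w      ≈⟨ +-congʳ (lc-∣ (residue-zero⇒∣ f≡0) v) ⟨
        lc f v +F u (proj₁ good) *F lc g w  ≈⟨ eq ⟩
        0#                                  ≈⟨ zeroʳ _ ⟨
        u (proj₁ good) *F 0#                ∎))
      ... | no _ | yes g≡0 = independent⇒∣ ind₁ f (begin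
        lc f v                              ≈⟨ +-identityʳ _ ⟨
        lc f v +F 0#                        ≈⟨ +-congˡ (zeroʳ _) ⟨
        lc f v +F u (proj₁ good) *F 0#      ≈⟨ +-congˡ (*-congˡ (lc-∣ (residue-zero⇒∣ g≡0) w)) ⟨
        lc f v +F u (proj₁ good) *F lc g w  ≈⟨ eq ⟩
        0#                                  ∎) , residue-zero⇒∣ g≡0
      ... | no f≢0 | no g≢0 with nonzero-surjective f≢0 | nonzero-surjective g≢0
      ... | a , a≗ | b , b≗ = contradiction (a , b , trans (+-cong (represents f a≗ v) (*-congˡ (represents g b≗ w))) eq)
                                            (proj₂ good)
        where
        represents : ∀ {m} {κ : Vector (Fin p) m} (h : Fin m → ℕ) → κ ≗ residue h → ∀ x →
                     linearCombination κ x ≈ lc h x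
        represents h κ≗ x = trans (linearCombination-cong κ≗ x) (sym (lc-residue h x))

    module _ {a} {X : Set a} (_≟X_ : (x y : X) → Dec (x ≡ y)) (h : X → Carrier) where

      weightedSum : (X → ℕ) → List X → Carrier
      weightedSum f = listSum (λ x → f x ×F h x)

      -- Coefficients attached to points survive a reordering of the list, while those attached to
      -- positions do not. Without repetitions in `xs` the latter can be turned into the former.
      independent-lookup : ∀ {xs} → Unique xs →
                           (∀ f → weightedSum f xs ≈ 0# → ∀ {x} → x ∈ₗ xs → p ∣ f x) →
                           LinearlyIndependent (h ∘ lookup xs)
      independent-lookup {xs} unique ind κ eq i =
        ∣∧<⇒≡0 (subst (p ∣_) (extend-lookup i) (ind extend (begin
          weightedSum extend xs
            ≈⟨ sum-lookup (λ x → extend x ×F h x) xs ⟨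
          sum (λ j → extend (lookup xs j) ×F h (lookup xs j))
            ≈⟨ sum-cong-≋ (λ j → reflexive (cong (_×F h (lookup xs j)) (extend-lookup j))) ⟩
          linearCombination κ (h ∘ lookup xs)
            ≈⟨ eq ⟩
          0# ∎) (∈-lookup i))) (toℕ<n (κ i))
        where
        extend : X → ℕ
        extend x with any? (λ j → lookup xs j ≟X x)
        ... | yes (j , _) = toℕ (κ j)
        -- An arbitrary default: the sum contains no term for a point off the list.
        ... | no _        = 0

        extend-lookup : ∀ j → extend (lookup xs j) ≡ toℕ (κ j)
        extend-lookup j with any? (λ k → lookup xs k ≟X lookup xs j)
        ... | yes (k , same) = cong (toℕ ∘ κ) (lookup-injective unique k j same)
        ... | no none        = contradiction (j , ≡.refl) none

        ∣∧<⇒≡0 : ∀ {k} → p ∣ k → k < p → k ≡ 0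
        ∣∧<⇒≡0 {zero}  _   _   = ≡.refl
        ∣∧<⇒≡0 {suc k} p∣k k<p = contradiction (∣⇒≤ p∣k) (ℕ.<⇒≱ k<p)

  -- Joining a pattern with a translate

  module PatternUnion {α : Carrier} (gen : GeneratesUnits α) (s t : ℕ) .{{_ : NonZero s}} .{{_ : NonZero t}}
                      (q≡1+st : q ≡ suc (s * t)) (coprime : Coprime s t)
                      (p : ℕ) (p-prime : Prime p) (n : ℕ) (q≡pⁿ : q ≡ p ^ n) where

    open Lattice gen s t q≡1+st coprime
    open LinearAlgebra p p-prime n q≡pⁿ

    private
      β = α ^F t
      γ = α ^F s

      a : Torus s t → Carrier
      a = A β γ

    module _ {S₁ S₂ : Pred (Torus s t) 0ℓ} (S₁? : Decidable S₁) (S₂? : Decidable S₂) where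

      -- For independent patterns and a unit `u`, this says that V₁ and u V₂ meet only in 0.
      JointlyIndependentAfterScaling : Carrier → Set _
      JointlyIndependentAfterScaling u =
        ∀ f g → lc f (restrict β γ S₁?) +F u *F lc g (restrict β γ S₂?) ≈ 0# →
        (∀ k → p ∣ f k) × (∀ l → p ∣ g l)

      ∃-jointly-independent-translate :
        LinearlyIndependentPattern β γ p S₁? → LinearlyIndependentPattern β γ p S₂? →
        size S₁? + size S₂? ≤ n → ∃₂ λ i j → JointlyIndependentAfterScaling (a (i , j))
      ∃-jointly-independent-translate ind₁ ind₂ sizes≤n =
        proj₁ (remQuot {s} t (proj₁ scaling)) , proj₂ (remQuot {s} t (proj₁ scaling)) , proj₂ scaling
        where
        point-injective : ∀ {k l} → remQuot {s} t k ≡ remQuot t l → k ≡ l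
        point-injective {k} {l} eq = ≡.trans (≡.sym (combine-remQuot {s} t k))
          (≡.trans (cong (λ x → combine (proj₁ x) (proj₂ x)) eq) (combine-remQuot {s} t l))

        scaling = ∃-jointly-independent ind₁ ind₂ sizes≤n
          (>-nonZero⁻¹ (s * t) {{ℕ.m*n≢0 s t}}) (≡.trans (≡.sym q≡pⁿ) q≡1+st)
          (a ∘ remQuot t) (A#0 ∘ remQuot t) (point-injective ∘ A-injective)

      position : ∀ {S : Pred (Torus s t) 0ℓ} (S? : Decidable S) {x} → x ∈ S →
                 ∃ λ k → x ≡ lookup (elements S?) k
      position S? x∈S = index (∈-elements⁺ S? x∈S) , lookup-index (∈-elements⁺ S? x∈S)

      module _ (i : Fin s) (j : Fin t) (good : JointlyIndependentAfterScaling (a (i , j))) where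

        private
          u = a (i , j)
          τ = T i j

        -- A common point makes an element of the first family equal to `u` times one of the second.
        -- The coefficients 1 and p - 1, the latter standing for -1, then form a relation, although
        -- `p` does not divide 1.
        translate-disjoint : Image τ S₂ ⊥ S₁
        translate-disjoint {y} ((x , x∈S₂ , τx≡y) , y∈S₁) with position S₁? y∈S₁ | position S₂? x∈S₂
        ... | k , y≡ | l , x≡ = contradiction p-prime (subst (¬_ ∘ Prime) (≡.sym p≡1) ¬prime[1])
          where
          v = restrict β γ S₁?
          w = restrict β γ S₂?

          relation : lc (single 1 k) v +F u *F lc (single (p ∸ 1) l) w ≈ 0#
          relation = begin
            lc (single 1 k) v +F u *F lc (single (p ∸ 1) l) w   ≈⟨ +-cong (lc-single 1 k v) (*-congˡ (lc-single (p ∸ 1) l w)) ⟩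
            1 ×F v k +F u *F ((p ∸ 1) ×F w l)                   ≈⟨ +-congˡ (×-comm-* (p ∸ 1) u (w l)) ⟩
            1 ×F v k +F (p ∸ 1) ×F (u *F w l)                   ≈⟨ +-congˡ (×-congʳ (p ∸ 1) translate) ⟩
            1 ×F v k +F (p ∸ 1) ×F v k                          ≈⟨ ×-homo-+ (v k) 1 (p ∸ 1) ⟨
            (1 + (p ∸ 1)) ×F v k                                ≡⟨ cong (_×F v k) (ℕ.m+[n∸m]≡n (ℕ.<⇒≤ 1<p)) ⟩
            p ×F v k                                            ≈⟨ p×x≈0 (v k) ⟩
            0#                                                  ∎
            where
            translate : u *F w l ≈ v k
            translate = begin
              u *F w l   ≡⟨ cong (λ z → u *F a z) x≡ ⟨
              u *F a x   ≈⟨ A-T i j x ⟨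
              a (τ x)    ≡⟨ cong a τx≡y ⟩
              a y        ≡⟨ cong a y≡ ⟩
              v k        ∎

          p≡1 : p ≡ 1
          p≡1 = ∣1⇒≡1 (subst (p ∣_) (single-diag 1 k) (proj₁ (good (single 1 k) (single (p ∸ 1) l) relation) k))

        -- A relation over the union separates into terms on S₁ and terms on the translate. Pulling
        -- the latter back along `τ` releases the factor `u` and leaves a relation to which `good`
        -- applies.
        ∪-translate-independent : LinearlyIndependentPattern β γ p (S₁? ∪? image? τ S₂?)
        ∪-translate-independent = independent-lookup
          (≡-dec _≟_ _≟_) a (elements-unique (S₁? ∪? image? τ S₂?))
          λ f eq x∈ → divides-on f
            (good (f ∘ lookup E₁) (f ∘ τ ∘ lookup E₂) (trans (sym (split f)) eq))
            (∈-elements⁻ (S₁? ∪? image? τ S₂?) x∈)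
          where
          E₁ = elements S₁?
          E₂ = elements S₂?

          divides-on : ∀ f → (∀ k → p ∣ f (lookup E₁ k)) × (∀ k → p ∣ f (τ (lookup E₂ k))) →
                       ∀ {x} → x ∈ S₁ ⊎ x ∈ Image τ S₂ → p ∣ f x
          divides-on f (p∣₁ , p∣₂) (inj₁ x∈S₁) with k , ≡.refl ← position S₁? x∈S₁ = p∣₁ k
          divides-on f (p∣₁ , p∣₂) (inj₂ (y , y∈S₂ , ≡.refl)) with k , ≡.refl ← position S₂? y∈S₂ = p∣₂ k

          split : ∀ f → listSum (λ x → f x ×F a x) (elements (S₁? ∪? image? τ S₂?)) ≈
                        lc (f ∘ lookup E₁) (a ∘ lookup E₁) +F u *F lc (f ∘ τ ∘ lookup E₂) (a ∘ lookup E₂)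
          split f = begin
            listSum term (elements (S₁? ∪? image? τ S₂?))
              ≈⟨ listSum-↭ term (elements-∪-image (T-injective i j) S₁? S₂? translate-disjoint) ⟩
            listSum term (E₁ ++ map τ E₂)
              ≈⟨ listSum-++ term E₁ (map τ E₂) ⟩
            listSum term E₁ +F listSum term (map τ E₂)
              ≈⟨ +-cong (sym (sum-lookup term E₁))
                        (trans (listSum-map term τ E₂) (sym (sum-lookup (term ∘ τ) E₂))) ⟩
            lc (f ∘ lookup E₁) (a ∘ lookup E₁) +F sum (term ∘ τ ∘ lookup E₂)
              ≈⟨ +-congˡ (sum-cong-≋ λ k → scale (lookup E₂ k)) ⟩
            lc (f ∘ lookup E₁) (a ∘ lookup E₁) +F sum (λ k → u *F (f (τ (lookup E₂ k)) ×F a (lookup E₂ k)))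
              ≈⟨ +-congˡ (*-distribˡ-sum u λ k → f (τ (lookup E₂ k)) ×F a (lookup E₂ k)) ⟨
            lc (f ∘ lookup E₁) (a ∘ lookup E₁) +F u *F lc (f ∘ τ ∘ lookup E₂) (a ∘ lookup E₂) ∎
            where
            term : Torus s t → Carrier
            term x = f x ×F a x

            scale : ∀ x → term (τ x) ≈ u *F (f (τ x) ×F a x)
            scale x = begin
              f (τ x) ×F a (τ x)      ≈⟨ ×-congʳ (f (τ x)) (A-T i j x) ⟩
              f (τ x) ×F (u *F a x)   ≈⟨ ×-comm-* (f (τ x)) u (a x) ⟨
              u *F (f (τ x) ×F a x)   ∎

mainTheorem3 :
    ∀ {c ℓ₁ ℓ₂} (p n : ℕ) → Prime p → 1 ≤ n →
    (s t : ℕ) .{{_ : NonZero s}} .{{_ : NonZero t}} →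
    p ^ n ∸ 1 ≡ s * t → s < t → gcd s t ≡ 1 →
    (F : HeytingField c ℓ₁ ℓ₂) →
    let open HeytingField F using (Carrier)
        open FieldNotions F
        open Over p
    in
    HasCardinality (p ^ n) →
    (α : Carrier) → GeneratesUnits α →
    let β = α ^F t
        γ = α ^F s
    in
    (S₁ S₂ : Pred (Torus s t) 0ℓ) (S₁? : Decidable S₁) (S₂? : Decidable S₂) →
    S₁ ⊥ S₂ →
    LinearlyIndependentPattern β γ p S₁? →
    LinearlyIndependentPattern β γ p S₂? →
    (m₁ m₂ : ℕ) → size S₁? ≡ m₁ → size S₂? ≡ m₂ →
    (d₁ d₂ : ℕ) →
    HasDimension (Span (restrict β γ S₁?)) d₁ →
    HasDimension (Span (restrict β γ S₂?)) d₂ →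
    d₁ + d₂ ≤ n →
    ∃₂ λ (a : Fin s) (b : Fin t) →
      (Image (T a b) S₂ ⊥ S₁) ×
      LinearlyIndependentPattern β γ p (S₁? ∪? image? (T a b) S₂?)
mainTheorem3 p n p-prime 1≤n s t pⁿ∸1≡st s<t gcd≡1 F card α gen S₁ S₂ S₁? S₂? S₁⊥S₂ ind₁ ind₂
  m₁ m₂ ≡.refl ≡.refl d₁ d₂ dim₁ dim₂ d₁+d₂≤n =
  let i , j , good = ∃-jointly-independent-translate S₁? S₂? ind₁ ind₂ sizes≤n
  in  i , j , translate-disjoint S₁? S₂? i j good , ∪-translate-independent S₁? S₂? i j good
  where
  instance
    pⁿ≢0 : NonZero (p ^ n)
    pⁿ≢0 = ℕ.m^n≢0 p n {{prime⇒nonZero p-prime}}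

  pⁿ≡1+st : p ^ n ≡ suc (s * t)
  pⁿ≡1+st = ≡.trans (≡.sym (ℕ.suc-pred (p ^ n))) (cong suc pⁿ∸1≡st)

  open FiniteFieldProperties F (p ^ n) card using (module LinearAlgebra; module PatternUnion)
  open LinearAlgebra p p-prime n ≡.refl using (independent⇒≤dimension)
  open PatternUnion gen s t pⁿ≡1+st (gcd≡1⇒coprime gcd≡1) p p-prime n ≡.refl

  -- The dimension bound enters the count through the sizes, since an independent pattern has at
  -- most as many points as its span has dimensions.
  sizes≤n : size S₁? + size S₂? ≤ n
  sizes≤n = ℕ.≤-trans
    (ℕ.+-mono-≤ (independent⇒≤dimension ind₁ dim₁) (independent⇒≤dimension ind₂ dim₂)) d₁+d₂≤n
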